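{- The competitive ratio of any deterministic algorithm for capacitated fully dynamic $2$-recoloring is $\Omega(n)$, for any resource augmentation $\varepsilon>0$, even on unweighted instances. That is, there are absolute constants $\kappa>0$ and $n_0$ such that for every even $n\ge n_0$, every $\varepsilon>0$, and every deterministic online algorithm $\mathcal A$ for unweighted fully dynamic capacitated $2$-recoloring on $n$ vertices using capacity $(1+\varepsilon)\frac n2$ per color: if there are numbers $\alpha$ and $\mu$, independent of the request sequence, with $\mathcal A_\sigma\le\alpha\, OPT_\sigma+\mu$ for every request sequence $\sigma$, then $\alpha\ge\kappa n$.
   Context: Unweighted fully dynamic capacitated $2$-recoloring. There is a fixed set $V$ of $n$ vertices, each of weight $1$, and an initial coloring $c_0:V\to\{1,2\}$ in which each color is used by at most $n/2$ vertices. A finite sequence $\sigma=(\sigma_1,\dots,\sigma_T)$ of requests, of arbitrary length, is revealed one at a time; each request $\sigma_t=(u_t,v_t)$ is a pair of distinct vertices. The graph formed by all requests need not be $2$-colorable. After each request $\sigma_t$ the algorithm must output a coloring $c_t:V\to\{1,2\}$ with $c_t(u_t)\ne c_t(v_t)$ (only the current request must be satisfied, not earlier ones), and the number of vertices of each color must not exceed the capacity at any time. Recoloring one vertex costs $1$, so the total cost is $\sum_{t=1}^T|\{v:c_t(v)\neq c_{t-1}(v)\}|$. A deterministic online algorithm determines $c_t$ from $c_0$ and $\sigma_1,\dots,\sigma_t$ only. $\mathcal A_\sigma$ denotes the total cost of $\mathcal A$ on $\sigma$, where $\mathcal A$ has capacity $(1+\varepsilon)\frac n2$ per color ($(1+\varepsilon)$-resource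 augmentation; for $\varepsilon\ge1$ this is no constraint). $OPT_\sigma$ denotes the minimum total cost of an offline algorithm (which knows all of $\sigma$ in advance) that has capacity $B=\frac n2$ per color. -}

module Defs where

open import Data.Fin.Base using (Fin)
open import Data.Fin.Properties using (_≟_)
open import Data.Integer.Base using (+_)
open import Data.List.Base using (List; []; _∷_; _∷ʳ_)
open import Data.List.Relation.Binary.Pointwise using (Pointwise)
open import Data.Nat.Base using (ℕ; _+_; _≤_)
open import Data.Product.Base using (_×_; ∃-syntax)
open import Data.Rational.Base as ℚ using (ℚ; _/_)
open import Data.Vec.Base using (allFin; count)
open import Relation.Binary.PropositionalEquality using (_≡_; _≢_)
open import Relation.Nullary.Decidable using (¬?)

fromℕ : ℕ → ℚ
fromℕ k = + k / 1

Color : Set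
Color = Fin 2

Coloring : ℕ → Set
Coloring n = Fin n → Color

record Request (n : ℕ) : Set where
  constructor request
  field
    u v : Fin n
    u≢v : u ≢ v

Satisfies : ∀ {n} → Request n → Coloring n → Set
Satisfies r c = c u ≢ c v
  where open Request r

usage : ∀ {n} → Coloring n → Color → ℕ
usage {n} c i = count (λ v → c v ≟ i) (allFin n)

WithinCapacity : ∀ {n} → ℚ → Coloring n → Set
WithinCapacity B c = ∀ i → fromℕ (usage c i) ℚ.≤ B

recoloringCost : ∀ {n} → Coloring n → Coloring n → ℕ
recoloringCost {n} c d = count (λ v → ¬? (d v ≟ c v)) (allFin n)

totalCost : ∀ {n} → Coloring n → List (Coloring n) → ℕ
totalCost c []       = 0
totalCost c (d ∷ ds) = recoloringCost c d + totalCost d ds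

-- A schedule for σ₁,…,σ_T is the list c₁,…,c_T; the initial coloring is not
-- part of it.
Feasible : ∀ {n} → ℚ → List (Request n) → List (Coloring n) → Set
Feasible B = Pointwise (λ r c → Satisfies r c × WithinCapacity B c)

-- `respond past r` is the coloring output on request r after the earlier
-- requests `past`, listed oldest first.  The initial coloring is not an
-- argument: it is fixed before the algorithm is chosen, so the algorithm may
-- depend on it.
record OnlineAlgorithm (n : ℕ) (B : ℚ) : Set where
  field
    respond   : List (Request n) → Request n → Coloring n
    satisfies : ∀ past r → Satisfies r (respond past r)
    capacity  : ∀ past r → WithinCapacity B (respond past r)

  scheduleAfter : List (Request n) → List (Request n) → List (Coloring n)
  scheduleAfter past []      = []
  scheduleAfter past (r ∷ σ) = respond past r ∷ scheduleAfter (past ∷ʳ r) σ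

  cost : Coloring n → List (Request n) → ℕ
  cost c₀ σ = totalCost c₀ (scheduleAfter [] σ)

baseCapacity : ℕ → ℚ
baseCapacity n = + n / 2

-- k is the minimum total cost of an offline schedule for σ from c₀ with
-- capacity n/2 per color.
IsOPT : ∀ {n} → Coloring n → List (Request n) → ℕ → Set
IsOPT {n} c₀ σ k =
    (∃[ cs ] Feasible (baseCapacity n) σ cs × totalCost c₀ cs ≡ k)
  × (∀ cs → Feasible (baseCapacity n) σ cs → k ≤ totalCost c₀ cs)

{-# OPTIONS --safe #-}

-- The adversary requests edges of an odd cycle through all vertices but one.
-- Every coloring has a monochromatic edge on it, and requesting such an edge
-- costs the online algorithm at least 1.  The colorings of the cycle with
-- exactly one monochromatic edge (the hole) extend to balanced colorings, and
-- flipping one cycle vertex moves the hole by one edge.  The adversary keeps a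
-- target coloring with one hole, which it moves greedily towards the online
-- coloring until its hole is monochromatic there; that edge is requested.
-- The number of moves is at most the online cost plus a constant, by the
-- Hamming distance as potential.  Meanwhile n - 2 offline schedules occupy
-- distinct holes other than the target's: when the target enters an occupied
-- hole, only its occupant moves, into the hole just left.  So all n - 2
-- schedules together cost at most twice the online cost plus a constant, hence
-- on average an O(1/n) fraction of it.
module Submission where

import Algebra.Properties.Semiring.Sum
open import Data.Bool.Base using (if_then_else_)
open import Data.Fin.Base as Fin using (Fin; zero; suc; inject₁; opposite; punchIn)
open import Data.Fin.Induction using (<-weakInduction)
open import Data.Fin.Properties
  using (_≟_; any?; suc-injective; opposite-involutive; punchInᵢ≢i; punchIn-injective)
open import Data.Fin.Relation.Unary.Top using (view; ‵fromℕ; ‵inject₁; view-fromℕ; view-inject₁)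
open import Data.Integer.Base as ℤ using (+_)
import Data.Integer.Properties as ℤ
open import Data.List.Base using (List; []; _∷_; _∷ʳ_)
open import Data.List.Relation.Binary.Pointwise using ([]; _∷_)
open import Data.Nat.Base as ℕ using (ℕ; zero; suc; z≤n; s≤s)
open import Data.Nat.Divisibility using (_∣_; divides)
open import Data.Nat.Induction using (<-rec)
import Data.Nat.Properties as ℕ
open import Data.Nat.Tactic.RingSolver using (solve-∀)
open import Data.Product.Base using (_×_; _,_; proj₁; proj₂; ∃-syntax)
open import Data.Rational.Base as ℚ using (ℚ; 0ℚ; 1ℚ; _+_; _*_; _≤_; _<_; _/_; *≤*; ↥_; ↧_)
open import Data.Rational.Literals using (fromℤ)
import Data.Rational.Properties as ℚ
open import Data.Rational.Unnormalised.Base using (mkℚᵘ; *≡*)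
open import Data.Sum.Base using (_⊎_; inj₁; inj₂)
open import Data.Vec.Base using (count; tabulate)
open import Data.Vec.Functional as Vector using (Vector; updateAt; tail)
open import Data.Vec.Functional.Properties using (updateAt-updates; updateAt-minimal)
open import Function.Base using (id; _∘_)
open import Relation.Binary.PropositionalEquality
open import Relation.Nullary.Decidable using (Dec; yes; no; does; ¬?; decidable-stable; from-yes)
open import Relation.Nullary.Negation using (¬_; contradiction)
open import Relation.Unary using (Pred; Decidable)
open import Defs

open Algebra.Properties.Semiring.Sum ℕ.+-*-semiring
  using (sum; sum-syntax; sum-remove; *-distribˡ-sum; sum-cong-≗; sum-replicate-zero; ∑-distrib-+)

private
  variable
    m n : ℕ

-- Finite sums of natural numbers and indicators.

sum-change : ∀ (f g : Vector ℕ n) v → (∀ j → j ≢ v → f j ≡ g j) → sum f ℕ.+ g v ≡ sum g ℕ.+ f v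
sum-change {suc n} f g v f≗g = begin
  sum f ℕ.+ g v                               ≡⟨ cong (ℕ._+ g v) (sum-remove {i = v} f) ⟩
  f v ℕ.+ sum (Vector.removeAt f v) ℕ.+ g v   ≡⟨ cong (λ r → f v ℕ.+ r ℕ.+ g v) (sum-cong-≗ λ j → f≗g _ (punchInᵢ≢i v j)) ⟩
  f v ℕ.+ sum (Vector.removeAt g v) ℕ.+ g v   ≡⟨ (λ x r y → solve x r y) (f v) _ (g v) ⟩
  g v ℕ.+ sum (Vector.removeAt g v) ℕ.+ f v   ≡⟨ cong (ℕ._+ f v) (sum-remove {i = v} g) ⟨
  sum g ℕ.+ f v                               ∎
  where
  open ≡-Reasoning
  solve : ∀ x r y → x ℕ.+ r ℕ.+ y ≡ y ℕ.+ r ℕ.+ x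
  solve = solve-∀

sum-supported : ∀ (f : Vector ℕ n) v → (∀ j → j ≢ v → f j ≡ 0) → sum f ≡ f v
sum-supported {n} f v f≗0 = begin
  sum f                                    ≡⟨ ℕ.+-identityʳ _ ⟨
  sum f ℕ.+ 0                              ≡⟨ sum-change f (Vector.replicate n 0) v f≗0 ⟩
  sum (Vector.replicate n 0) ℕ.+ f v       ≡⟨ cong (ℕ._+ f v) (sum-replicate-zero n) ⟩
  f v                                      ∎
  where open ≡-Reasoning

sum-mono-≤ : ∀ {f g : Vector ℕ n} → (∀ j → f j ℕ.≤ g j) → sum f ℕ.≤ sum g
sum-mono-≤ {zero}  f≤g = z≤n
sum-mono-≤ {suc n} f≤g = ℕ.+-mono-≤ (f≤g zero) (sum-mono-≤ (f≤g ∘ suc))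

sum-≤-* : ∀ {f : Vector ℕ n} {b} → (∀ j → f j ℕ.≤ b) → sum f ℕ.≤ n ℕ.* b
sum-≤-* {zero}  f≤b = z≤n
sum-≤-* {suc n} f≤b = ℕ.+-mono-≤ (f≤b zero) (sum-≤-* (f≤b ∘ suc))

*-≤-sum : ∀ {f : Vector ℕ n} {b} → (∀ j → b ℕ.≤ f j) → n ℕ.* b ℕ.≤ sum f
*-≤-sum {zero}  b≤f = z≤n
*-≤-sum {suc n} b≤f = ℕ.+-mono-≤ (b≤f zero) (*-≤-sum (b≤f ∘ suc))

indicator : ∀ {P : Set} → Dec P → ℕ
indicator P? = if does P? then 1 else 0

indicator-yes : ∀ {P : Set} (P? : Dec P) → P → indicator P? ≡ 1
indicator-yes (yes _) p = refl
indicator-yes (no ¬p) p = contradiction p ¬p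

indicator-no : ∀ {P : Set} (P? : Dec P) → ¬ P → indicator P? ≡ 0
indicator-no (yes p) ¬p = contradiction p ¬p
indicator-no (no _)  ¬p = refl

indicator≤1 : ∀ {P : Set} (P? : Dec P) → indicator P? ℕ.≤ 1
indicator≤1 (yes _) = s≤s z≤n
indicator≤1 (no _)  = z≤n

count-tabulate : ∀ {A : Set} {P : Pred A _} (P? : Decidable P) (f : Fin n → A) →
                 count P? (tabulate f) ≡ ∑[ j < n ] indicator (P? (f j))
count-tabulate {zero}  P? f = refl
count-tabulate {suc n} P? f with P? (f zero)
... | yes _ = cong suc (count-tabulate P? (f ∘ suc))
... | no  _ = count-tabulate P? (f ∘ suc)

-- Used with `f` listing the holes of the offline schedules: a hole has at most one occupant, so at
-- most one schedule has to move.
sum-indicator-injective : ∀ (f : Fin m → Fin n) → (∀ {j k} → f j ≡ f k → j ≡ k) → ∀ y →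
                          ∑[ j < m ] indicator (f j ≟ y) ℕ.≤ 1
sum-indicator-injective {m} f inj y with any? (λ j → f j ≟ y)
... | yes (j , fj≡y) = begin
  ∑[ k < m ] indicator (f k ≟ y)  ≡⟨ sum-supported _ j (λ k k≢j → indicator-no (f k ≟ y) λ fk≡y → k≢j (inj (trans fk≡y (sym fj≡y)))) ⟩
  indicator (f j ≟ y)             ≤⟨ indicator≤1 (f j ≟ y) ⟩
  1                               ∎
  where open ℕ.≤-Reasoning
... | no ∄j = begin
  ∑[ k < m ] indicator (f k ≟ y)  ≡⟨ sum-cong-≗ (λ k → indicator-no (f k ≟ y) λ fk≡y → ∄j (k , fk≡y)) ⟩
  sum (Vector.replicate m 0)      ≡⟨ sum-replicate-zero m ⟩
  0                               ≤⟨ z≤n ⟩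
  1                               ∎
  where open ℕ.≤-Reasoning

-- Hamming distance between colorings.

mismatch : Color → Color → ℕ
mismatch x y = indicator (¬? (y ≟ x))

mismatch-refl : ∀ x → mismatch x x ≡ 0
mismatch-refl x = indicator-no (¬? (x ≟ x)) λ x≢x → x≢x refl

mismatch≤1 : ∀ x y → mismatch x y ℕ.≤ 1
mismatch≤1 x y = indicator≤1 (¬? (y ≟ x))

mismatch-triangle : ∀ x y z → mismatch x z ℕ.≤ mismatch x y ℕ.+ mismatch y z
mismatch-triangle x y z with y ≟ x
... | yes refl = ℕ.≤-refl
... | no _     = ℕ.≤-trans (mismatch≤1 x z) (s≤s z≤n)

recoloringCost-sum : ∀ (c d : Coloring n) → recoloringCost c d ≡ ∑[ j < n ] mismatch (c j) (d j)
recoloringCost-sum c d = count-tabulate (λ v → ¬? (d v ≟ c v)) id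

usage-sum : ∀ (c : Coloring n) x → usage c x ≡ ∑[ j < n ] indicator (c j ≟ x)
usage-sum c x = count-tabulate (λ v → c v ≟ x) id

recoloringCost-refl : ∀ (c : Coloring n) → recoloringCost c c ≡ 0
recoloringCost-refl {n} c = begin
  recoloringCost c c                  ≡⟨ recoloringCost-sum c c ⟩
  ∑[ j < n ] mismatch (c j) (c j)     ≡⟨ sum-cong-≗ (mismatch-refl ∘ c) ⟩
  sum (Vector.replicate n 0)          ≡⟨ sum-replicate-zero n ⟩
  0                                   ∎
  where open ≡-Reasoning

recoloringCost-triangle : ∀ (c d e : Coloring n) →
                          recoloringCost c e ℕ.≤ recoloringCost c d ℕ.+ recoloringCost d e
recoloringCost-triangle {n} c d e = begin
  recoloringCost c e                                            ≡⟨ recoloringCost-sum c e ⟩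
  ∑[ j < n ] mismatch (c j) (e j)                               ≤⟨ sum-mono-≤ (λ j → mismatch-triangle (c j) (d j) (e j)) ⟩
  ∑[ j < n ] (mismatch (c j) (d j) ℕ.+ mismatch (d j) (e j))    ≡⟨ ∑-distrib-+ (λ j → mismatch (c j) (d j)) _ ⟩
  ∑[ j < n ] mismatch (c j) (d j) ℕ.+ ∑[ j < n ] mismatch (d j) (e j)
    ≡⟨ cong₂ ℕ._+_ (recoloringCost-sum c d) (recoloringCost-sum d e) ⟨
  recoloringCost c d ℕ.+ recoloringCost d e                     ∎
  where open ℕ.≤-Reasoning

recoloringCost≤n : ∀ (c d : Coloring n) → recoloringCost c d ℕ.≤ n
recoloringCost≤n {n} c d = begin
  recoloringCost c d                 ≡⟨ recoloringCost-sum c d ⟩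
  ∑[ j < n ] mismatch (c j) (d j)    ≤⟨ sum-≤-* (λ j → mismatch≤1 (c j) (d j)) ⟩
  n ℕ.* 1                            ≡⟨ ℕ.*-identityʳ n ⟩
  n                                  ∎
  where open ℕ.≤-Reasoning

recoloringCost-tail : ∀ (c d : Coloring (suc n)) →
                      recoloringCost (tail c) (tail d) ℕ.≤ recoloringCost c d
recoloringCost-tail {n} c d = begin
  recoloringCost (tail c) (tail d)                 ≡⟨ recoloringCost-sum (tail c) (tail d) ⟩
  ∑[ j < n ] mismatch (c (suc j)) (d (suc j))      ≤⟨ ℕ.m≤n+m _ _ ⟩
  ∑[ j < suc n ] mismatch (c j) (d j)              ≡⟨ recoloringCost-sum c d ⟨
  recoloringCost c d                               ∎
  where open ℕ.≤-Reasoning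

recoloringCost-positive : ∀ (c d : Coloring n) v → d v ≢ c v → 1 ℕ.≤ recoloringCost c d
recoloringCost-positive {suc n} c d v dv≢cv = begin
  1                                         ≡⟨ indicator-yes (¬? (d v ≟ c v)) dv≢cv ⟨
  mismatch (c v) (d v)                      ≤⟨ ℕ.m≤m+n _ _ ⟩
  mismatch (c v) (d v) ℕ.+ _                ≡⟨ sum-remove {i = v} (λ j → mismatch (c j) (d j)) ⟨
  ∑[ j < suc n ] mismatch (c j) (d j)       ≡⟨ recoloringCost-sum c d ⟨
  recoloringCost c d                        ∎
  where open ℕ.≤-Reasoning

-- The joint cost of moving a family of colorings, one per offline schedule.
drift : (Fin m → Coloring n) → (Fin m → Coloring n) → ℕ
drift {m} P Q = ∑[ b < m ] recoloringCost (P b) (Q b)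

drift-refl : ∀ (P : Fin m → Coloring n) → drift P P ≡ 0
drift-refl {m} P = trans (sum-cong-≗ (recoloringCost-refl ∘ P)) (sum-replicate-zero m)

drift-triangle : ∀ (P Q R : Fin m → Coloring n) → drift P R ℕ.≤ drift P Q ℕ.+ drift Q R
drift-triangle {m} P Q R = begin
  drift P R
    ≤⟨ sum-mono-≤ (λ b → recoloringCost-triangle (P b) (Q b) (R b)) ⟩
  ∑[ b < m ] (recoloringCost (P b) (Q b) ℕ.+ recoloringCost (Q b) (R b))
    ≡⟨ ∑-distrib-+ (λ b → recoloringCost (P b) (Q b)) (λ b → recoloringCost (Q b) (R b)) ⟩
  drift P Q ℕ.+ drift Q R
    ∎
  where open ℕ.≤-Reasoning

-- Lets the intermediate moves of a schedule be charged one by one, although it outputs a single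
-- coloring per request.
totalCost-triangle : ∀ (c d : Coloring n) es →
                     totalCost c es ℕ.≤ recoloringCost c d ℕ.+ totalCost d es
totalCost-triangle c d []       = z≤n
totalCost-triangle c d (e ∷ es) = begin
  recoloringCost c e ℕ.+ totalCost e es                                ≤⟨ ℕ.+-monoˡ-≤ _ (recoloringCost-triangle c d e) ⟩
  recoloringCost c d ℕ.+ recoloringCost d e ℕ.+ totalCost e es         ≡⟨ ℕ.+-assoc (recoloringCost c d) _ _ ⟩
  recoloringCost c d ℕ.+ (recoloringCost d e ℕ.+ totalCost e es)       ∎
  where open ℕ.≤-Reasoning

-- Recoloring a single vertex.

≢⇒opposite≡ : ∀ {x y : Color} → x ≢ y → opposite x ≡ y
≢⇒opposite≡ {zero}     {zero}     x≢y = contradiction refl x≢y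
≢⇒opposite≡ {zero}     {suc zero} x≢y = refl
≢⇒opposite≡ {suc zero} {zero}     x≢y = refl
≢⇒opposite≡ {suc zero} {suc zero} x≢y = contradiction refl x≢y

opposite≢ : ∀ (x : Color) → opposite x ≢ x
opposite≢ zero       ()
opposite≢ (suc zero) ()

recolor : Fin n → Coloring n → Coloring n
recolor v c = updateAt c v opposite

recolor-at : ∀ v (c : Coloring n) → recolor v c v ≡ opposite (c v)
recolor-at v c = updateAt-updates v c

recolor-other : ∀ {v j} (c : Coloring n) → j ≢ v → recolor v c j ≡ c j
recolor-other {v = v} {j} c j≢v = updateAt-minimal j v c j≢v

-- With two colors, flipping a vertex that disagrees with `d` makes it agree.
recolor-closer : ∀ v (c d : Coloring n) → d v ≢ c v →
                 suc (recoloringCost (recolor v c) d) ≡ recoloringCost c d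
recolor-closer {n} v c d dv≢cv = begin
  suc (recoloringCost (recolor v c) d)  ≡⟨ ℕ.+-comm 1 _ ⟩
  recoloringCost (recolor v c) d ℕ.+ 1
    ≡⟨ cong₂ ℕ._+_ (recoloringCost-sum (recolor v c) d) (sym (indicator-yes (¬? (d v ≟ c v)) dv≢cv)) ⟩
  ∑[ j < n ] mismatch (recolor v c j) (d j) ℕ.+ mismatch (c v) (d v)
    ≡⟨ sum-change _ _ v (λ j j≢v → cong (λ x → mismatch x (d j)) (recolor-other c j≢v)) ⟩
  ∑[ j < n ] mismatch (c j) (d j) ℕ.+ mismatch (recolor v c v) (d v)
    ≡⟨ cong (λ x → _ ℕ.+ mismatch x (d v)) (trans (recolor-at v c) (≢⇒opposite≡ (dv≢cv ∘ sym))) ⟩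
  ∑[ j < n ] mismatch (c j) (d j) ℕ.+ mismatch (d v) (d v)
    ≡⟨ cong₂ ℕ._+_ (recoloringCost-sum c d) (sym (mismatch-refl (d v))) ⟨
  recoloringCost c d ℕ.+ 0              ≡⟨ ℕ.+-identityʳ _ ⟩
  recoloringCost c d                    ∎
  where open ≡-Reasoning

recolor-cost : ∀ v (c : Coloring n) → recoloringCost c (recolor v c) ℕ.≤ 1
recolor-cost {n} v c = begin
  recoloringCost c (recolor v c)                 ≡⟨ recoloringCost-sum c (recolor v c) ⟩
  ∑[ j < n ] mismatch (c j) (recolor v c j)      ≡⟨ sum-supported _ v (λ j j≢v → trans (cong (mismatch (c j)) (recolor-other c j≢v)) (mismatch-refl (c j))) ⟩
  mismatch (c v) (recolor v c v)                 ≤⟨ mismatch≤1 (c v) (recolor v c v) ⟩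
  1                                              ∎
  where open ℕ.≤-Reasoning

recolor-usage : ∀ v (c : Coloring n) x →
                usage (recolor v c) x ℕ.+ indicator (c v ≟ x) ≡ usage c x ℕ.+ indicator (opposite (c v) ≟ x)
recolor-usage {n} v c x = begin
  usage (recolor v c) x ℕ.+ indicator (c v ≟ x)
    ≡⟨ cong (ℕ._+ indicator (c v ≟ x)) (usage-sum (recolor v c) x) ⟩
  ∑[ j < n ] indicator (recolor v c j ≟ x) ℕ.+ indicator (c v ≟ x)
    ≡⟨ sum-change _ _ v (λ j j≢v → cong (λ y → indicator (y ≟ x)) (recolor-other c j≢v)) ⟩
  ∑[ j < n ] indicator (c j ≟ x) ℕ.+ indicator (recolor v c v ≟ x)
    ≡⟨ cong₂ ℕ._+_ (sym (usage-sum c x)) (cong (λ y → indicator (y ≟ x)) (recolor-at v c)) ⟩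
  usage c x ℕ.+ indicator (opposite (c v) ≟ x)   ∎
  where open ≡-Reasoning

-- The cyclic successor and the vertex off the cycle.

next : Fin (suc n) → Fin (suc n)
next i with view i
... | ‵fromℕ     = zero
... | ‵inject₁ j = suc j

next-fromℕ : ∀ n → next (Fin.fromℕ n) ≡ zero
next-fromℕ n rewrite view-fromℕ n = refl

next-inject₁ : ∀ (j : Fin n) → next (inject₁ j) ≡ suc j
next-inject₁ j rewrite view-inject₁ j = refl

next-injective : ∀ {i j : Fin (suc n)} → next i ≡ next j → i ≡ j
next-injective {i = i} {j} eq with view i | view j
... | ‵fromℕ     | ‵fromℕ     = refl
... | ‵inject₁ _ | ‵inject₁ _ = cong inject₁ (suc-injective eq)

next≢ : ∀ (i : Fin (suc (suc n))) → next i ≢ i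
next≢ i eq with view i
next≢ .(suc (inject₁ j)) eq | ‵inject₁ (suc j) = suc≢inject₁ j (suc-injective eq)
  where
  suc≢inject₁ : ∀ {n} (j : Fin n) → suc j ≢ inject₁ j
  suc≢inject₁ (suc j) eq = suc≢inject₁ j (suc-injective eq)

previous : ∀ (i : Fin (suc n)) → ∃[ j ] next j ≡ i
previous {n} zero    = Fin.fromℕ n , next-fromℕ n
previous     (suc j) = inject₁ j , next-inject₁ j

recoloringCost-suc : ∀ (c d : Coloring (suc n)) →
                     recoloringCost c d ≡ mismatch (c zero) (d zero) ℕ.+ recoloringCost (tail c) (tail d)
recoloringCost-suc c d = trans (recoloringCost-sum c d)
  (cong (mismatch (c zero) (d zero) ℕ.+_) (sym (recoloringCost-sum (tail c) (tail d))))

usage-suc : ∀ (c : Coloring (suc n)) x → usage c x ≡ indicator (c zero ≟ x) ℕ.+ usage (tail c) x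
usage-suc c x = trans (usage-sum c x) (cong (indicator (c zero ≟ x) ℕ.+_) (sym (usage-sum (tail c) x)))

-- The two colorings differ only in that vertex zero and `v`, which have opposite colors, exchange
-- them.
usage-exchange : ∀ v (s : Coloring n) {y z} → y ≡ s v → z ≡ opposite (s v) → ∀ x →
                 usage (y Vector.∷ recolor v s) x ≡ usage (z Vector.∷ s) x
usage-exchange v s refl refl x = begin
  usage (s v Vector.∷ recolor v s) x                   ≡⟨ usage-suc (s v Vector.∷ recolor v s) x ⟩
  indicator (s v ≟ x) ℕ.+ usage (recolor v s) x        ≡⟨ ℕ.+-comm (indicator (s v ≟ x)) _ ⟩
  usage (recolor v s) x ℕ.+ indicator (s v ≟ x)        ≡⟨ recolor-usage v s x ⟩
  usage s x ℕ.+ indicator (opposite (s v) ≟ x)         ≡⟨ ℕ.+-comm (usage s x) _ ⟩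
  indicator (opposite (s v) ≟ x) ℕ.+ usage s x         ≡⟨ usage-suc (opposite (s v) Vector.∷ s) x ⟨
  usage (opposite (s v) Vector.∷ s) x                  ∎
  where open ≡-Reasoning

-- Colorings of the cycle with one hole.

module OddCycle (k cap : ℕ) where

  -- There are `n = ℓ + 1` vertices: vertex zero and the cycle. Of the `ℓ` possible holes the target
  -- takes one, leaving `suc k = n - 2` for the offline schedules.
  ℓ : ℕ
  ℓ = suc (suc k)

  -- Edge i of the cycle joins i to next i; v is the vertex shared by the
  -- adjacent edges i and j.
  Crossing : Fin ℓ → Fin ℓ → Fin ℓ → Set
  Crossing i j v = (v ≡ next i × j ≡ v) ⊎ (v ≡ i × next j ≡ i)

  crossing-sym : ∀ {i j v} → Crossing i j v → Crossing j i v
  crossing-sym (inj₁ (v≡i⁺ , j≡v)) = inj₂ (sym j≡v , sym (trans j≡v v≡i⁺))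
  crossing-sym (inj₂ (v≡i , j⁺≡i)) = inj₁ (trans v≡i (sym j⁺≡i) , sym v≡i)

  -- Vertex zero lies off the cycle and compensates for the color that is in
  -- excess on it, namely that of the monochromatic edge i.
  extend : Fin ℓ → Coloring ℓ → Coloring (suc ℓ)
  extend i s = opposite (s i) Vector.∷ s

  record HoleAt (i : Fin ℓ) (s : Coloring ℓ) : Set where
    field
      mono     : s i ≡ s (next i)
      proper   : ∀ j → j ≢ i → s j ≢ s (next j)
      balanced : ∀ x → usage (extend i s) x ≡ cap

  -- Only the edges `i` and `j` contain `v`, so flipping `v` makes the old hole bichromatic, the
  -- adjacent edge monochromatic, and leaves all other edges alone. Vertex zero exchanges colors
  -- with `v`, which keeps the balance.
  cross : ∀ {i j v s} → Crossing i j v → HoleAt i s → HoleAt j (recolor v s)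
  cross {i} {v = v} {s} (inj₁ (refl , refl)) H = record
    { mono     = trans (recolor-at v s)
                   (trans (≢⇒opposite≡ (proper v v≢i)) (sym (recolor-other s (next≢ v))))
    ; proper   = proper′
    ; balanced = λ x → trans
        (usage-exchange v s (trans (cong opposite (recolor-at v s)) (opposite-involutive (s v)))
                            (cong opposite mono) x)
        (balanced x)
    }
    where
    open HoleAt H
    v≢i : v ≢ i
    v≢i = next≢ i
    proper′ : ∀ j → j ≢ v → recolor v s j ≢ recolor v s (next j)
    proper′ j j≢v eq with j ≟ i
    ... | yes refl = opposite≢ (s v)
          (trans (sym (recolor-at v s)) (trans (sym eq) (trans (recolor-other s j≢v) mono)))
    ... | no j≢i   = proper j j≢i
          (trans (sym (recolor-other s j≢v)) (trans eq (recolor-other s (j≢i ∘ next-injective))))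
  -- The mirror case: the hole moves backwards, and `i` now names the new hole while `v = next i` is
  -- the old one.
  cross {j = i} {v = v} {s} (inj₂ (refl , refl)) H = record
    { mono     = trans (recolor-other s i≢v) (trans (sym sv⁻) (sym (recolor-at v s)))
    ; proper   = proper′
    ; balanced = λ x → trans
        (usage-exchange v s
          (trans (cong opposite (trans (recolor-other s i≢v) (sym sv⁻))) (opposite-involutive (s v)))
          refl x)
        (balanced x)
    }
    where
    open HoleAt H
    i≢v : i ≢ v
    i≢v = next≢ i ∘ sym
    sv⁻ : opposite (s v) ≡ s i
    sv⁻ = ≢⇒opposite≡ (proper i i≢v ∘ sym)
    proper′ : ∀ j → j ≢ i → recolor v s j ≢ recolor v s (next j)
    proper′ j j≢i eq with j ≟ v
    ... | yes refl = opposite≢ (s v)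
          (trans (sym (recolor-at v s)) (trans eq (trans (recolor-other s (next≢ v)) (sym mono))))
    ... | no j≢v   = proper j j≢v
          (trans (sym (recolor-other s j≢v)) (trans eq (recolor-other s (j≢i ∘ next-injective))))

  -- Moves of the offline schedules.

  record State : Set where
    constructor state
    field
      hole   : Fin ℓ
      cycle  : Coloring ℓ
      holeAt : HoleAt hole cycle

    coloring : Coloring (suc ℓ)
    coloring = extend hole cycle

  open State

  -- Reverses the target's move: the occupant of `h′` flips the same vertex `v` and ends in `h`, the
  -- hole that the target leaves.
  shift : ∀ {h h′ v} → Crossing h h′ v → State → State
  shift {h} {h′} {v} X p with hole p ≟ h′
  ... | yes p≡h′ = state h (recolor v (cycle p))
                     (cross (crossing-sym X) (subst (λ i → HoleAt i (cycle p)) p≡h′ (holeAt p)))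
  ... | no _     = p

  -- The 2 accounts for `v` and for vertex zero.
  shift-cost : ∀ {h h′ v} (X : Crossing h h′ v) p →
               recoloringCost (coloring p) (coloring (shift X p)) ℕ.≤ 2 ℕ.* indicator (hole p ≟ h′)
  shift-cost {h} {h′} {v} X p with hole p ≟ h′
  ... | yes _ = begin
    recoloringCost (coloring p) (extend h (recolor v (cycle p)))
      ≡⟨ recoloringCost-suc (coloring p) (extend h (recolor v (cycle p))) ⟩
    mismatch (coloring p zero) (opposite (recolor v (cycle p) h)) ℕ.+ recoloringCost (cycle p) (recolor v (cycle p))
      ≤⟨ ℕ.+-mono-≤ (mismatch≤1 (coloring p zero) (opposite (recolor v (cycle p) h))) (recolor-cost v (cycle p)) ⟩
    2                                                                ∎
    where open ℕ.≤-Reasoning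
  ... | no _  = ℕ.≤-reflexive (recoloringCost-refl (coloring p))

  shift-avoids : ∀ {h h′ v} (X : Crossing h h′ v) p → h ≢ h′ → hole (shift X p) ≢ h′
  shift-avoids {h′ = h′} X p h≢h′ with hole p ≟ h′
  ... | yes _    = h≢h′
  ... | no p≢h′  = p≢h′

  -- The move renames `h′` to `h` and fixes every other hole; this is injective because `h` was free
  -- before.
  shift-injective : ∀ {h h′ v} (X : Crossing h h′ v) p q → hole p ≢ h → hole q ≢ h →
                    hole (shift X p) ≡ hole (shift X q) → hole p ≡ hole q
  shift-injective {h′ = h′} X p q p≢h q≢h eq with hole p ≟ h′ | hole q ≟ h′
  ... | yes p≡h′ | yes q≡h′ = trans p≡h′ (sym q≡h′)
  ... | yes _    | no _     = contradiction (sym eq) q≢h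
  ... | no _     | yes _    = contradiction eq p≢h
  ... | no _     | no _     = eq

  record Offline (h : Fin ℓ) : Set where
    field
      park     : Fin (suc k) → State
      distinct : ∀ {a b} → hole (park a) ≡ hole (park b) → a ≡ b
      avoids   : ∀ a → hole (park a) ≢ h

    plan : Fin (suc k) → Coloring (suc ℓ)
    plan a = coloring (park a)

  open Offline

  crossing-distinct : ∀ {h h′ v} → Crossing h h′ v → h ≢ h′
  crossing-distinct {h}       (inj₁ (refl , refl)) = next≢ h ∘ sym
  crossing-distinct {h′ = h′} (inj₂ (refl , refl)) = next≢ h′

  -- The holes are distinct, so `h′` has at most one occupant, and no other schedule moves.
  offline-step : ∀ {h h′ v} → Crossing h h′ v → (O : Offline h) →
                 ∃[ O′ ] drift (plan O) (plan {h′} O′) ℕ.≤ 2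
  offline-step {h} {h′} X O = O′ , bound
    where
    O′ : Offline h′
    O′ = record
      { park     = shift X ∘ park O
      ; distinct = λ eq → distinct O (shift-injective X (park O _) (park O _) (avoids O _) (avoids O _) eq)
      ; avoids   = λ a → shift-avoids X (park O a) (crossing-distinct X)
      }
    open ℕ.≤-Reasoning
    bound : drift (plan O) (plan O′) ℕ.≤ 2
    bound = begin
      drift (plan O) (plan O′)
        ≤⟨ sum-mono-≤ (λ a → shift-cost X (park O a)) ⟩
      ∑[ a < suc k ] (2 ℕ.* indicator (hole (park O a) ≟ h′))
        ≡⟨ *-distribˡ-sum 2 (λ a → indicator (hole (park O a) ≟ h′)) ⟨
      2 ℕ.* (∑[ a < suc k ] indicator (hole (park O a) ≟ h′))
        ≤⟨ ℕ.*-monoʳ-≤ 2 (sum-indicator-injective (hole ∘ park O) (distinct O) h′) ⟩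
      2  ∎

  -- Greedy descent of the target.

  record Configuration : Set where
    field
      target  : State
      offline : Offline (hole target)

  open Configuration

  -- Here `a` is the online coloring on the cycle. Once this holds, requesting the target's hole
  -- forces a recoloring.
  Mono : Coloring ℓ → Configuration → Set
  Mono a G = a (hole (target G)) ≡ a (next (hole (target G)))

  -- If the target's hole is not monochromatic in `a`, one of its ends is colored differently in `a`
  -- and in the target. Flipping that end moves the hole by one edge and lowers the distance by 1,
  -- so twice the distance pays for a drift of at most 2. The bound `m` makes the recursion
  -- structural.
  descent : ∀ m (a : Coloring ℓ) G → recoloringCost (cycle (target G)) a ℕ.≤ m →
            ∃[ G′ ] Mono a G′ ×
              drift (plan (offline G)) (plan (offline G′))
                ℕ.+ 2 ℕ.* recoloringCost (cycle (target G′)) a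
                ℕ.≤ 2 ℕ.* recoloringCost (cycle (target G)) a
  descent m a G d≤m with a (hole (target G)) ≟ a (next (hole (target G)))
  ... | yes mono = G , mono , ℕ.≤-reflexive (cong (ℕ._+ 2 ℕ.* recoloringCost (cycle (target G)) a)
          (drift-refl (plan (offline G))))
  ... | no ¬mono = go m d≤m (disagreement (a h ≟ s h))
    where
    h = hole (target G)
    s = cycle (target G)
    h⁻ = proj₁ (previous h)
    disagreement : Dec (a h ≡ s h) → ∃[ v ] ∃[ h′ ] Crossing h h′ v × a v ≢ s v
    disagreement (no ah≢sh)   = h , h⁻ , inj₂ (refl , proj₂ (previous h)) , ah≢sh
    -- The target is monochromatic on its hole and `a` is not, so agreement at `h` forces
    -- disagreement at `next h`.
    disagreement (yes ah≡sh)  = next h , next h , inj₁ (refl , refl) ,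
      λ eq → ¬mono (trans ah≡sh (trans (HoleAt.mono (holeAt (target G))) (sym eq)))
    go : ∀ m → recoloringCost s a ℕ.≤ m → (∃[ v ] ∃[ h′ ] Crossing h h′ v × a v ≢ s v) →
         ∃[ G′ ] Mono a G′ ×
              drift (plan (offline G)) (plan (offline G′))
                ℕ.+ 2 ℕ.* recoloringCost (cycle (target G′)) a
                ℕ.≤ 2 ℕ.* recoloringCost s a
    go zero    d≤m (v , h′ , X , av≢sv) =
      contradiction (subst (ℕ._≤ 0) (sym (recolor-closer v s a av≢sv)) d≤m) λ ()
    go (suc m) d≤m (v , h′ , X , av≢sv) = G″ , mono″ , bound
      where
      step = offline-step X (offline G)
      G′ : Configuration
      G′ = record { target  = state h′ (recolor v s) (cross X (holeAt (target G)))
                  ; offline = proj₁ step }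
      closer = recolor-closer v s a av≢sv
      rest = descent m a G′ (ℕ.≤-pred (subst (ℕ._≤ suc m) (sym closer) d≤m))
      G″ = proj₁ rest
      mono″ = proj₁ (proj₂ rest)
      P = plan (offline G)
      P′ = plan (offline G′)
      P″ = plan (offline G″)
      open ℕ.≤-Reasoning
      bound : drift P P″ ℕ.+ 2 ℕ.* recoloringCost (cycle (target G″)) a ℕ.≤ 2 ℕ.* recoloringCost s a
      bound = begin
        drift P P″ ℕ.+ 2 ℕ.* recoloringCost (cycle (target G″)) a
          ≤⟨ ℕ.+-monoˡ-≤ _ (drift-triangle P P′ P″) ⟩
        drift P P′ ℕ.+ drift P′ P″ ℕ.+ 2 ℕ.* recoloringCost (cycle (target G″)) a
          ≡⟨ ℕ.+-assoc (drift P P′) (drift P′ P″) _ ⟩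
        drift P P′ ℕ.+ (drift P′ P″ ℕ.+ 2 ℕ.* recoloringCost (cycle (target G″)) a)
          ≤⟨ ℕ.+-mono-≤ (proj₂ step) (proj₂ (proj₂ rest)) ⟩
        2 ℕ.+ 2 ℕ.* recoloringCost (recolor v s) a
          ≡⟨ ℕ.*-suc 2 _ ⟨
        2 ℕ.* suc (recoloringCost (recolor v s) a)
          ≡⟨ cong (2 ℕ.*_) closer ⟩
        2 ℕ.* recoloringCost s a  ∎

  -- The request game.

  module Game {B B′ : ℚ} (cap≤B : fromℕ cap ℚ.≤ B) (A : OnlineAlgorithm (suc ℓ) B′) where

    open OnlineAlgorithm A

    request-at : Fin ℓ → Request (suc ℓ)
    request-at h = request (suc h) (suc (next h)) (next≢ h ∘ sym ∘ suc-injective)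

    -- The requested edge is the target's hole; each parked coloring has its only hole elsewhere and
    -- is therefore proper on that edge.
    plan-serves : ∀ {h} (O : Offline h) b →
                  Satisfies (request-at h) (plan O b) × WithinCapacity B (plan O b)
    plan-serves {h} O b =
      HoleAt.proper p h (avoids O b ∘ sym) ,
      λ x → subst (λ u → fromℕ u ℚ.≤ B) (sym (HoleAt.balanced p x)) cap≤B
      where p = holeAt (park O b)

    -- P b is the coloring from which the b-th offline schedule starts.
    record Outcome (past : List (Request (suc ℓ))) (c : Coloring (suc ℓ)) (T : ℕ)
                   (P : Fin (suc k) → Coloring (suc ℓ)) (D : ℕ) : Set where
      field
        requests : List (Request (suc ℓ))
        schedule : Fin (suc k) → List (Coloring (suc ℓ))
        feasible : ∀ b → Feasible B requests (schedule b)

      online : ℕ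
      online = totalCost c (scheduleAfter past requests)

      field
        T≤online : T ℕ.≤ online
        offline≤ : ∑[ b < suc k ] totalCost (P b) (schedule b) ℕ.≤ 2 ℕ.* online ℕ.+ D

    open Outcome

    -- Moves made between two requests are not output separately: by the triangle inequality they
    -- are absorbed into the recoloring at the next request.
    approach : ∀ {past c T D E} P Q → drift P Q ℕ.+ E ℕ.≤ D → Outcome past c T Q E → Outcome past c T P D
    approach {D = D} {E} P Q drift≤ R = record
      { requests = requests R
      ; schedule = schedule R
      ; feasible = feasible R
      ; T≤online = T≤online R
      ; offline≤ = begin
          ∑[ b < suc k ] totalCost (P b) (schedule R b)
            ≤⟨ sum-mono-≤ (λ b → totalCost-triangle (P b) (Q b) (schedule R b)) ⟩
          ∑[ b < suc k ] (recoloringCost (P b) (Q b) ℕ.+ totalCost (Q b) (schedule R b))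
            ≡⟨ ∑-distrib-+ (λ b → recoloringCost (P b) (Q b)) (λ b → totalCost (Q b) (schedule R b)) ⟩
          drift P Q ℕ.+ ∑[ b < suc k ] totalCost (Q b) (schedule R b)
            ≤⟨ ℕ.+-monoʳ-≤ (drift P Q) (offline≤ R) ⟩
          drift P Q ℕ.+ (2 ℕ.* online R ℕ.+ E)
            ≡⟨ rearrange (drift P Q) (2 ℕ.* online R) E ⟩
          2 ℕ.* online R ℕ.+ (drift P Q ℕ.+ E)
            ≤⟨ ℕ.+-monoʳ-≤ (2 ℕ.* online R) drift≤ ⟩
          2 ℕ.* online R ℕ.+ D
            ∎
      }
      where
      open ℕ.≤-Reasoning
      rearrange : ∀ x y z → x ℕ.+ (y ℕ.+ z) ≡ y ℕ.+ (x ℕ.+ z)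
      rearrange = solve-∀

    -- Twice the Hamming potential: each unit of it pays for one move of the
    -- target, which costs the offline schedules at most 2.
    debt : Coloring (suc ℓ) → Configuration → ℕ
    debt c G = 2 ℕ.* recoloringCost (cycle (target G)) (tail c)

    -- Each round requests the target's hole, which is monochromatic online, and then lets the
    -- target descend. An online recoloring of cost x raises the debt by at most 2x, whence the
    -- factor 2 in `offline≤`; the debt released by the descent pays for the offline moves.
    play : ∀ T past c G → Mono (tail c) G → Outcome past c T (plan (offline G)) (debt c G)
    play zero past c G mono = record
      { requests = []
      ; schedule = λ _ → []
      ; feasible = λ _ → []
      ; T≤online = z≤n
      ; offline≤ = subst (ℕ._≤ debt c G) (sym (sum-replicate-zero (suc k))) z≤n
      }
    play (suc T) past c G mono = record
      { requests = r ∷ requests rest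
      -- The schedules already satisfy `r` and stay put. Their moves in the descent that follows
      -- appear only with the next request.
      ; schedule = λ b → plan (offline G) b ∷ schedule rest b
      ; feasible = λ b → plan-serves (offline G) b ∷ feasible rest b
      ; T≤online = ℕ.+-mono-≤ forced (T≤online rest)
      ; offline≤ = begin
          ∑[ b < suc k ] (recoloringCost (plan (offline G) b) (plan (offline G) b) ℕ.+ totalCost (plan (offline G) b) (schedule rest b))
            ≡⟨ sum-cong-≗ (λ b → cong (ℕ._+ totalCost (plan (offline G) b) (schedule rest b)) (recoloringCost-refl (plan (offline G) b))) ⟩
          ∑[ b < suc k ] totalCost (plan (offline G) b) (schedule rest b)
            ≤⟨ offline≤ rest ⟩
          2 ℕ.* online rest ℕ.+ debt d G
            ≤⟨ ℕ.+-monoʳ-≤ (2 ℕ.* online rest) debt-growth ⟩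
          2 ℕ.* online rest ℕ.+ 2 ℕ.* (recoloringCost (cycle (target G)) (tail c) ℕ.+ recoloringCost c d)
            ≡⟨ rearrange (online rest) (recoloringCost (cycle (target G)) (tail c)) (recoloringCost c d) ⟩
          2 ℕ.* (recoloringCost c d ℕ.+ online rest) ℕ.+ debt c G
            ∎
      }
      where
      open ℕ.≤-Reasoning
      h = hole (target G)
      r = request-at h
      d = respond past r
      moved = descent (recoloringCost (cycle (target G)) (tail d)) (tail d) G ℕ.≤-refl
      rest : Outcome (past ∷ʳ r) d T (plan (offline G)) (debt d G)
      rest = approach (plan (offline G)) (plan (offline (proj₁ moved))) (proj₂ (proj₂ moved)) (play T (past ∷ʳ r) d (proj₁ moved) (proj₁ (proj₂ moved)))
      -- If both ends of the requested edge kept their colors, the edge would still be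
      -- monochromatic.
      forced : 1 ℕ.≤ recoloringCost c d
      forced with d (suc h) ≟ c (suc h)
      ... | no d≢c  = recoloringCost-positive c d (suc h) d≢c
      ... | yes d≡c = recoloringCost-positive c d (suc (next h))
              λ d≡c⁺ → satisfies past r (trans d≡c (trans mono (sym d≡c⁺)))
      debt-growth : debt d G ℕ.≤ 2 ℕ.* (recoloringCost (cycle (target G)) (tail c) ℕ.+ recoloringCost c d)
      debt-growth = ℕ.*-monoʳ-≤ 2 (ℕ.≤-trans
        (recoloringCost-triangle (cycle (target G)) (tail c) (tail d))
        (ℕ.+-monoʳ-≤ _ (recoloringCost-tail c d)))
      rearrange : ∀ x y z → 2 ℕ.* x ℕ.+ 2 ℕ.* (y ℕ.+ z) ≡ 2 ℕ.* (z ℕ.+ x) ℕ.+ 2 ℕ.* y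
      rearrange = solve-∀

    -- The constant covers the start: each of the `suc k` schedules recolors at most all `suc ℓ`
    -- vertices to reach its first hole, and the initial debt is at most `2 * ℓ`. A first descent
    -- prepares the first request.
    adversary : ∀ T c → Configuration →
                Outcome [] c T (λ _ → c) (suc k ℕ.* suc ℓ ℕ.+ 2 ℕ.* ℓ)
    adversary T c G =
      approach (λ _ → c) (plan (offline G)) start≤
        (approach (plan (offline G)) (plan (offline (proj₁ moved))) (proj₂ (proj₂ moved))
          (play T [] c (proj₁ moved) (proj₁ (proj₂ moved))))
      where
      moved = descent (recoloringCost (cycle (target G)) (tail c)) (tail c) G ℕ.≤-refl
      start≤ : drift (λ _ → c) (plan (offline G)) ℕ.+ debt c G ℕ.≤ suc k ℕ.* suc ℓ ℕ.+ 2 ℕ.* ℓ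
      start≤ = ℕ.+-mono-≤ (sum-≤-* (λ b → recoloringCost≤n c (plan (offline G) b)))
                          (ℕ.*-monoʳ-≤ 2 (recoloringCost≤n (cycle (target G)) (tail c)))

  -- The starting configuration.

  configuration : (∃[ s ] HoleAt (Fin.fromℕ (suc k)) s) → Configuration
  configuration (s , H) = record
    { target  = stateAt zero
    ; offline = record
      { park     = stateAt ∘ punchIn zero
      ; distinct = punchIn-injective zero _ _
      ; avoids   = punchInᵢ≢i zero
      }
    }
    where
    step : ∀ {i j} → next i ≡ j → (∃[ s ] HoleAt i s) → ∃[ s ] HoleAt j s
    step {j = j} i⁺≡j (s , H) = recolor j s , cross (inj₁ (sym i⁺≡j , refl)) H
    everyHole : ∀ i → ∃[ s ] HoleAt i s
    -- The given hole is the last edge. One crossing wraps it around to edge zero, and induction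
    -- carries it through all edges in order.
    everyHole = <-weakInduction _ (step (next-fromℕ _) (s , H)) (λ i → step (next-inject₁ i))
    stateAt : Fin ℓ → State
    stateAt i = state i (proj₁ (everyHole i)) (proj₂ (everyHole i))

alternating : Coloring n
alternating zero          = zero
alternating (suc zero)    = suc zero
alternating (suc (suc j)) = alternating j

alternating-inject₁ : ∀ (j : Fin n) → alternating (inject₁ j) ≡ alternating j
alternating-inject₁ zero          = refl
alternating-inject₁ (suc zero)    = refl
alternating-inject₁ (suc (suc j)) = alternating-inject₁ j

alternating-suc : ∀ (j : Fin n) → alternating (suc j) ≡ opposite (alternating j)
alternating-suc zero          = refl
alternating-suc (suc zero)    = refl
alternating-suc (suc (suc j)) = alternating-suc j

alternating-last : ∀ q → alternating (Fin.fromℕ (q ℕ.* 2)) ≡ zero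
alternating-last zero    = refl
alternating-last (suc q) = alternating-last q

-- On an odd path color zero occurs once more than color one; the first term is the vertex off the
-- cycle, colored one to compensate. Each induction step adds one vertex of each color.
alternating-balanced : ∀ q x → indicator (suc zero ≟ x) ℕ.+ ∑[ j < suc (q ℕ.* 2) ] indicator (alternating j ≟ x) ≡ suc q
alternating-balanced zero    zero       = refl
alternating-balanced zero    (suc zero) = refl
alternating-balanced (suc q) zero       = cong suc (alternating-balanced q zero)
alternating-balanced (suc q) (suc zero) = cong suc (alternating-balanced q (suc zero))

-- With `n = 2q + 4` the cycle has odd length `2q + 3`, and the capacity `q + 2` is `n / 2`. Both
-- ends of the alternating path have color zero, so the edge closing the cycle is the only hole.
alternating-holeAt : ∀ q → let open OddCycle (suc (q ℕ.* 2)) (suc (suc q)) in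
                     HoleAt (Fin.fromℕ (suc q ℕ.* 2)) alternating
alternating-holeAt q = record
  { mono     = trans last≡0 (cong alternating (sym (next-fromℕ (suc q ℕ.* 2))))
  ; proper   = proper
  ; balanced = λ x → trans (usage-sum (extend last alternating) x)
                 (trans (cong (λ y → indicator (opposite y ≟ x) ℕ.+ ∑[ j < ℓ ] indicator (alternating j ≟ x)) last≡0)
                   (alternating-balanced (suc q) x))
  }
  where
  open OddCycle (suc (q ℕ.* 2)) (suc (suc q))
  last : Fin ℓ
  last = Fin.fromℕ (suc q ℕ.* 2)
  last≡0 : alternating last ≡ zero
  last≡0 = alternating-last (suc q)
  proper : ∀ (j : Fin ℓ) → j ≢ last → alternating j ≢ alternating (next j)
  proper j j≢last eq with view j
  ... | ‵fromℕ     = j≢last refl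
  ... | ‵inject₁ i = opposite≢ (alternating i)
          (trans (sym (alternating-suc i)) (trans (sym eq) (alternating-inject₁ i)))

-- Natural numbers inside the rationals.

fromℕ≡fromℤ : ∀ k → fromℕ k ≡ fromℤ (+ k)
fromℕ≡fromℤ k = ℚ.↥p/↧p≡p (fromℤ (+ k))

fromℕ-+ : ∀ a b → fromℕ (a ℕ.+ b) ≡ fromℕ a + fromℕ b
fromℕ-+ a b rewrite fromℕ≡fromℤ a | fromℕ≡fromℤ b =
  cong (_/ 1) (cong₂ ℤ._+_ (sym (ℤ.*-identityʳ (+ a))) (sym (ℤ.*-identityʳ (+ b))))

fromℕ-* : ∀ a b → fromℕ (a ℕ.* b) ≡ fromℕ a * fromℕ b
fromℕ-* a b rewrite fromℕ≡fromℤ a | fromℕ≡fromℤ b = cong (_/ 1) (ℤ.pos-* a b)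

fromℕ-mono-≤ : ∀ {a b} → a ℕ.≤ b → fromℕ a ≤ fromℕ b
fromℕ-mono-≤ {a} {b} a≤b rewrite fromℕ≡fromℤ a | fromℕ≡fromℤ b =
  *≤* (ℤ.*-monoʳ-≤-nonNeg (+ 1) (ℤ.+≤+ a≤b))

fromℕ-cancel-≤ : ∀ {a b} → fromℕ a ≤ fromℕ b → a ℕ.≤ b
fromℕ-cancel-≤ {a} {b} a≤b rewrite fromℕ≡fromℤ a | fromℕ≡fromℤ b =
  ℤ.drop‿+≤+ (ℤ.*-cancelʳ-≤-pos (+ a) (+ b) (+ 1) (ℚ.drop-*≤* a≤b))

fromℕ-nonNegative : ∀ k → ℚ.NonNegative (fromℕ k)
fromℕ-nonNegative k = ℚ.normalize-nonNeg k 1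

-- The denominator is at least 1. This lets a natural number stand in for the rational additive term
-- `μ`.
p≤fromℕ∣↥p∣ : ∀ p → p ≤ fromℕ ℤ.∣ ↥ p ∣
p≤fromℕ∣↥p∣ p rewrite fromℕ≡fromℤ ℤ.∣ ↥ p ∣ = *≤* (begin
  ↥ p ℤ.* + 1             ≡⟨ ℤ.*-identityʳ (↥ p) ⟩
  ↥ p                     ≤⟨ i≤∣i∣ (↥ p) ⟩
  + ℤ.∣ ↥ p ∣             ≡⟨ ℤ.*-identityʳ _ ⟨
  + ℤ.∣ ↥ p ∣ ℤ.* + 1     ≤⟨ ℤ.*-monoˡ-≤-nonNeg (+ ℤ.∣ ↥ p ∣) (ℤ.+≤+ (s≤s z≤n)) ⟩
  + ℤ.∣ ↥ p ∣ ℤ.* ↧ p     ∎)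
  where
  open ℤ.≤-Reasoning
  i≤∣i∣ : ∀ i → i ℤ.≤ + ℤ.∣ i ∣
  i≤∣i∣ (+ _)       = ℤ.≤-refl
  i≤∣i∣ ℤ.-[1+ _ ] = ℤ.-≤+

fromℕ≤baseCapacity : ∀ q → fromℕ q ≤ baseCapacity (q ℕ.* 2)
fromℕ≤baseCapacity q = ℚ.≤-reflexive (ℚ.fromℚᵘ-cong {mkℚᵘ (+ q) 0} {mkℚᵘ (+ (q ℕ.* 2)) 1} (*≡* (begin
  + q ℤ.* + 2            ≡⟨ ℤ.pos-* q 2 ⟨
  + (q ℕ.* 2)            ≡⟨ ℤ.*-identityʳ _ ⟨
  + (q ℕ.* 2) ℤ.* + 1    ∎)))
  where open ≡-Reasoning

-- From the offline schedules to the competitive ratio.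

κ : ℚ
κ = + 1 / 8

-- Multiplying by 8, the reciprocal of `κ`, leads to natural numbers. The conclusion speaks of the
-- cost `off` of an actual schedule instead of the optimum, so that it can be summed over the
-- schedules.
clear-denominators : ∀ n α μ C opt off → α ≤ κ * fromℕ n → fromℕ C ≤ α * fromℕ opt + μ → opt ℕ.≤ off →
                     8 ℕ.* C ℕ.≤ n ℕ.* off ℕ.+ 8 ℕ.* ℤ.∣ ↥ μ ∣
clear-denominators n α μ C opt off α≤κn C≤ opt≤off = fromℕ-cancel-≤ (begin
  fromℕ (8 ℕ.* C)                                     ≡⟨ fromℕ-* 8 C ⟩
  fromℕ 8 * fromℕ C                                   ≤⟨ ℚ.*-monoˡ-≤-nonNeg (fromℕ 8) C≤′ ⟩
  fromℕ 8 * (κ * fromℕ (n ℕ.* off) + fromℕ M)         ≡⟨ ℚ.*-distribˡ-+ (fromℕ 8) (κ * fromℕ (n ℕ.* off)) (fromℕ M) ⟩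
  fromℕ 8 * (κ * fromℕ (n ℕ.* off)) + fromℕ 8 * fromℕ M
    ≡⟨ cong₂ _+_ (trans (sym (ℚ.*-assoc (fromℕ 8) κ (fromℕ (n ℕ.* off)))) (ℚ.*-identityˡ (fromℕ (n ℕ.* off)))) (sym (fromℕ-* 8 M)) ⟩
  fromℕ (n ℕ.* off) + fromℕ (8 ℕ.* M)                 ≡⟨ fromℕ-+ (n ℕ.* off) (8 ℕ.* M) ⟨
  fromℕ (n ℕ.* off ℕ.+ 8 ℕ.* M)                       ∎)
  where
  open ℚ.≤-Reasoning
  M = ℤ.∣ ↥ μ ∣
  C≤′ : fromℕ C ≤ κ * fromℕ (n ℕ.* off) + fromℕ M
  C≤′ = begin
    fromℕ C                                    ≤⟨ C≤ ⟩
    α * fromℕ opt + μ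
      ≤⟨ ℚ.+-mono-≤ (ℚ.*-monoʳ-≤-nonNeg (fromℕ opt) {{fromℕ-nonNegative opt}} α≤κn) (p≤fromℕ∣↥p∣ μ) ⟩
    κ * fromℕ n * fromℕ opt + fromℕ M
      ≡⟨ cong (_+ fromℕ M) (trans (ℚ.*-assoc κ (fromℕ n) (fromℕ opt)) (cong (κ *_) (sym (fromℕ-* n opt)))) ⟩
    κ * fromℕ (n ℕ.* opt) + fromℕ M
      ≤⟨ ℚ.+-monoˡ-≤ (fromℕ M) (ℚ.*-monoˡ-≤-nonNeg κ (fromℕ-mono-≤ (ℕ.*-monoʳ-≤ n opt≤off))) ⟩
    κ * fromℕ (n ℕ.* off) + fromℕ M            ∎

-- Minima exist only classically; this suffices because the inequalities to be
-- derived from them are decidable.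
¬¬-minimum : ∀ {P : ℕ → Set} k → P k → ¬ ¬ (∃[ m ] m ℕ.≤ k × P m × (∀ j → P j → m ℕ.≤ j))
¬¬-minimum {P} = <-rec _ λ k rec Pk noMin →
  noMin (k , ℕ.≤-refl , Pk , λ j Pj → ℕ.≮⇒≥ λ j<k →
    rec j<k Pj λ (m , m≤j , min) → noMin (m , ℕ.≤-trans m≤j (ℕ.<⇒≤ j<k) , min))

¬¬-OPT : ∀ {n} (c₀ : Coloring n) σ cs → Feasible (baseCapacity n) σ cs →
         ¬ ¬ (∃[ opt ] opt ℕ.≤ totalCost c₀ cs × IsOPT c₀ σ opt)
¬¬-OPT {n} c₀ σ cs feasible noOPT = ¬¬-minimum
  {λ j → ∃[ ds ] Feasible (baseCapacity n) σ ds × totalCost c₀ ds ≡ j}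
  (totalCost c₀ cs) (cs , feasible , refl)
  λ (opt , opt≤ , attained , least) →
    noOPT (opt , opt≤ , attained , λ ds f → least _ (ds , f , refl))

-- E bounds the initial cost of the offline schedules and M the additive term μ.
averaging : ∀ k n C E M (off : Fin (suc k) → ℕ) → n ℕ.≤ 2 ℕ.* suc k →
            (∀ b → 8 ℕ.* C ℕ.≤ n ℕ.* off b ℕ.+ 8 ℕ.* M) →
            ∑[ b < suc k ] off b ℕ.≤ 2 ℕ.* C ℕ.+ E →
            ¬ (suc (E ℕ.+ 2 ℕ.* M) ℕ.≤ C)
averaging k n C E M off n≤2K C≤off off≤ large = ℕ.<-irrefl refl (begin-strict
  2 ℕ.* E ℕ.+ 8 ℕ.* M                       ≤⟨ ℕ.+-monoˡ-≤ (8 ℕ.* M) (ℕ.*-monoˡ-≤ E {2} {4} (s≤s (s≤s z≤n))) ⟩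
  4 ℕ.* E ℕ.+ 8 ℕ.* M                       ≡⟨ factor E M ⟩
  4 ℕ.* (E ℕ.+ 2 ℕ.* M)                     <⟨ ℕ.*-monoʳ-< 4 large ⟩
  4 ℕ.* C                                   ≤⟨ ℕ.+-cancelˡ-≤ (4 ℕ.* C) _ _ bound ⟩
  2 ℕ.* E ℕ.+ 8 ℕ.* M                       ∎)
  where
  open ℕ.≤-Reasoning
  K = suc k
  factor : ∀ x y → 4 ℕ.* x ℕ.+ 8 ℕ.* y ≡ 4 ℕ.* (x ℕ.+ 2 ℕ.* y)
  factor = solve-∀
  double : ∀ x → 4 ℕ.* x ℕ.+ 4 ℕ.* x ≡ 8 ℕ.* x
  double = solve-∀
  collect : ∀ K C E M → 2 ℕ.* K ℕ.* (2 ℕ.* C ℕ.+ E) ℕ.+ K ℕ.* (8 ℕ.* M) ≡ K ℕ.* (4 ℕ.* C ℕ.+ (2 ℕ.* E ℕ.+ 8 ℕ.* M))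
  collect = solve-∀
  -- Summing the `K` inequalities and using `n ≤ 2K`, the offline costs contribute at most `4C + 2E`
  -- on average. The 8 from `κ` thus leaves half of `8C` to be bounded by a constant.
  bound : 4 ℕ.* C ℕ.+ 4 ℕ.* C ℕ.≤ 4 ℕ.* C ℕ.+ (2 ℕ.* E ℕ.+ 8 ℕ.* M)
  bound = ℕ.*-cancelˡ-≤ K (begin
    K ℕ.* (4 ℕ.* C ℕ.+ 4 ℕ.* C)                          ≡⟨ cong (K ℕ.*_) (double C) ⟩
    K ℕ.* (8 ℕ.* C)                                      ≤⟨ *-≤-sum C≤off ⟩
    ∑[ b < K ] (n ℕ.* off b ℕ.+ 8 ℕ.* M)                 ≡⟨ ∑-distrib-+ (λ b → n ℕ.* off b) (λ _ → 8 ℕ.* M) ⟩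
    ∑[ b < K ] (n ℕ.* off b) ℕ.+ ∑[ b < K ] (8 ℕ.* M)    ≤⟨ ℕ.+-mono-≤ (ℕ.≤-reflexive (sym (*-distribˡ-sum n off))) (sum-≤-* {n = K} (λ _ → ℕ.≤-refl)) ⟩
    n ℕ.* sum off ℕ.+ K ℕ.* (8 ℕ.* M)                    ≤⟨ ℕ.+-monoˡ-≤ _ (ℕ.*-mono-≤ n≤2K off≤) ⟩
    2 ℕ.* K ℕ.* (2 ℕ.* C ℕ.+ E) ℕ.+ K ℕ.* (8 ℕ.* M)      ≡⟨ collect K C E M ⟩
    K ℕ.* (4 ℕ.* C ℕ.+ (2 ℕ.* E ℕ.+ 8 ℕ.* M))            ∎)

theorem2 : ∃[ κ ] ∃[ n₀ ] 0ℚ < κ ×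
    (∀ (n : ℕ) → n₀ ℕ.≤ n → 2 ∣ n →
    ∀ (ε : ℚ) → 0ℚ < ε →
    ∀ (c₀ : Coloring n) → WithinCapacity (baseCapacity n) c₀ →
    ∀ (A : OnlineAlgorithm n ((1ℚ + ε) * baseCapacity n)) →
    ∀ (α μ : ℚ) →
    (∀ (σ : List (Request n)) (opt : ℕ) → IsOPT c₀ σ opt →
    fromℕ (OnlineAlgorithm.cost A c₀ σ) ≤ α * fromℕ opt + μ) →
    κ * fromℕ n ≤ α)
-- From `n = 4` on, the odd cycle has at least three vertices and `n` is at most `2 * (n - 2)`, as
-- the averaging requires.
theorem2 = κ , 4 , from-yes (0ℚ ℚ.<? κ) , lowerBound
  where
  lowerBound : ∀ (n : ℕ) → 4 ℕ.≤ n → 2 ∣ n →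
    ∀ (ε : ℚ) → 0ℚ < ε →
    ∀ (c₀ : Coloring n) → WithinCapacity (baseCapacity n) c₀ →
    ∀ (A : OnlineAlgorithm n ((1ℚ + ε) * baseCapacity n)) →
    ∀ (α μ : ℚ) →
    (∀ (σ : List (Request n)) (opt : ℕ) → IsOPT c₀ σ opt →
    fromℕ (OnlineAlgorithm.cost A c₀ σ) ≤ α * fromℕ opt + μ) →
    κ * fromℕ n ≤ α
  lowerBound _ ()                (divides zero refl)
  lowerBound _ (s≤s (s≤s ()))    (divides (suc zero) refl)
  lowerBound n _ (divides (suc (suc q)) refl) _ _ c₀ _ A α μ competitive =
    -- Every round costs the online algorithm at least 1, so this many rounds reach the cost that
    -- `averaging` refutes.
    conclude (adversary (suc (E ℕ.+ 2 ℕ.* M)) c₀ (configuration (alternating , alternating-holeAt q)))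
    where
    k = suc (q ℕ.* 2)
    M = ℤ.∣ ↥ μ ∣
    E = suc k ℕ.* n ℕ.+ 2 ℕ.* suc (suc k)
    open OddCycle k (suc (suc q))
    open Game (fromℕ≤baseCapacity (suc (suc q))) A
    n≤2K : n ℕ.≤ 2 ℕ.* suc k
    n≤2K = subst (n ℕ.≤_) (sym (double q)) (ℕ.m≤m+n n (q ℕ.* 2))
      where
      double : ∀ q → 2 ℕ.* (2 ℕ.+ q ℕ.* 2) ≡ 4 ℕ.+ q ℕ.* 2 ℕ.+ q ℕ.* 2
      double = solve-∀
    conclude : Outcome [] c₀ (suc (E ℕ.+ 2 ℕ.* M)) (λ _ → c₀) E → κ * fromℕ n ≤ α
    conclude R = decidable-stable (κ * fromℕ n ℚ.≤? α) λ κn≰α →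
      averaging k n online E M off n≤2K (bound κn≰α) offline≤ T≤online
      where
      open Outcome R
      off : Fin (suc k) → ℕ
      off b = totalCost c₀ (schedule b)
      bound : ¬ (κ * fromℕ n ≤ α) → ∀ b → 8 ℕ.* online ℕ.≤ n ℕ.* off b ℕ.+ 8 ℕ.* M
      bound κn≰α b = decidable-stable (8 ℕ.* online ℕ.≤? n ℕ.* off b ℕ.+ 8 ℕ.* M) λ ≰ →
        ¬¬-OPT c₀ requests (schedule b) (feasible b) λ (opt , opt≤ , isOPT) →
          ≰ (clear-denominators n α μ online opt (off b)
              (ℚ.<⇒≤ (ℚ.≰⇒> κn≰α)) (competitive requests opt isOPT) opt≤)
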